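{- For all constants $0 < c_1 \le c_2$ there is a constant $c > 0$ such that the following holds. Let $k \le n$ be positive integers and let $h$ be an integer with $2 \le h \le k$ and $c_1 \log(n/k + 1) \le h \le c_2 \log(n/k+1)$; let $\ell = \lfloor k/h \rfloor$. If in the $\ell$-variant cup game on $n$ cups some sequence of $T$ rounds produces a state in which some cup has fill at least $4k$, then $T \ge c\, h \ell^3$ (and hence $T \ge c' k^3/h^2$ for a constant $c' > 0$ depending only on $c_1,c_2$).
   Context: The $\ell$-variant cup game on $n$ cups (for a positive integer $\ell$): the fills are integers, all initially $0$. In each round, the player chooses an integer $k_0 \ge 0$ and an integer $q \ge 1$ such that at least $2q$ cups have fill exactly $k_0$; then $q$ of these cups are raised to fill $k_0+1$, and $q$ other cups among them are lowered to $k_0 - 1$, except that if $k_0$ is a multiple of $\ell$ (a checkpoint $0, \ell, 2\ell, \dots$) these $q$ other cups instead stay at $k_0$. (Thus once a cup reaches a checkpoint it never goes below it, and all fills stay non-negative.) If no valid choice exists the game ends. -}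

module Defs where

open import Data.Nat using (ℕ; zero; suc; _+_; _*_; _∸_; _≤_; _/_)
open import Data.Nat.Divisibility using (_∣_)
open import Data.Nat.Properties using (_≟_)
open import Data.Nat.Divisibility using (_∣?_)
open import Data.Fin using (Fin)
open import Data.Fin.Subset using (Subset; _∈_; _∉_; ∣_∣)
open import Data.Vec using (lookup)
open import Data.Bool using (Bool; true; false; if_then_else_)
open import Relation.Nullary using (Dec; yes; no)
open import Relation.Binary.PropositionalEquality using (_≡_)

State : ℕ → Set
State n = Fin n → ℕ

initial : (n : ℕ) → State n
initial n _ = 0

-- Floor division, with the (irrelevant) convention k / 0 = 0.
fdiv : ℕ → ℕ → ℕ
fdiv k zero = 0
fdiv k (suc h) = k / suc h

lowered : (ℓ k0 : ℕ) → ℕ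
lowered ℓ k0 with ℓ ∣? k0
... | yes _ = k0
... | no _  = k0 ∸ 1

after : {n : ℕ} → (ℓ k0 : ℕ) → (up down : Subset n) → State n → State n
after ℓ k0 up down s i with lookup up i | lookup down i
... | true  | _     = suc k0
... | false | true  = lowered ℓ k0
... | false | false = s i

-- One valid round of the ℓ-variant cup game taking state s to state s'.
-- The player picks k0 and q ≥ 1 and two disjoint sets of q cups each, all of
-- fill exactly k0 (so at least 2q cups have fill k0); `up` is raised, `down`
-- is lowered (or stays, at a checkpoint).
record Round {n : ℕ} (ℓ : ℕ) (s s' : State n) : Set where
  field
    k0       : ℕ
    up down  : Subset n
    q        : ℕ
    q≥1      : 1 ≤ q
    up-size  : ∣ up ∣ ≡ q
    down-size : ∣ down ∣ ≡ q
    disjoint : ∀ i → i ∈ up → i ∉ down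
    up-fill   : ∀ i → i ∈ up → s i ≡ k0
    down-fill : ∀ i → i ∈ down → s i ≡ k0
    result   : ∀ i → s' i ≡ after ℓ k0 up down s i

data Run {n : ℕ} (ℓ : ℕ) : ℕ → State n → State n → Set where
  done : ∀ {s} → Run ℓ 0 s s
  step : ∀ {T s s' s''} → Round ℓ s s' → Run ℓ T s' s'' → Run ℓ (suc T) s s''

{-# OPTIONS --safe #-}
module Submission where

-- Let D be a constant and cut the heights into segments [jℓ, (j+1)ℓ). On the
-- cup fills consider Φ = Σ w, where w(jℓ + u) = (D+1)^j (ℓ² + D u²), and the
-- pair sum G = ΣΣ g, a weighted version of Σ max. A round raising m cups from
-- height x, with z = m (D+1)^⌊x/ℓ⌋, raises Φ by at most 2Dz but raises G by at
-- least 2z², while ℓ³ G ≤ 2 Φ². Completing the square, the energy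
-- 4Φ² − ℓ³G ∈ [2Φ², 4Φ²] grows by a factor of at most 1 + 18 D²/ℓ³ per round.
-- On the other hand no two adjacent heights below an occupied one are ever both
-- empty, so a cup of fill 4k forces k cups of fill at least 2k ≥ 2hℓ, hence
-- Φ ≥ k (D+1)^(2h) ℓ². Initially Φ = n ℓ², and n ≤ 2^(hq) k as c₁ = p/q ≥ 1/q, so for D = 2^(q+1)
-- the energy has grown by a factor of at least 2^h, which takes Ω(h ℓ³) rounds.

open import Defs
open import Data.Bool using (Bool; true; false)
open import Data.Fin using (Fin; zero; suc)
open import Data.Fin.Subset using (Subset; ∣_∣)
open import Data.Nat
open import Data.Nat.Divisibility using (_∣?_; m%n≡0⇒n∣m; n∣m⇒m%n≡0; divides-refl)
open import Data.Nat.DivMod hiding (result)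
open import Data.Nat.Properties
open import Data.Nat.Tactic.RingSolver using (solve-∀)
open import Data.Product using (Σ; _×_; ∃; _,_; proj₁; proj₂)
open import Data.Sum using (_⊎_; inj₁; inj₂)
open import Data.Vec using ([]; _∷_; lookup)
open import Data.Vec.Properties using (lookup⇒[]=)
open import Function using (_∘_)
open import Relation.Binary.Definitions using (tri<; tri≈; tri>)
open import Relation.Binary.PropositionalEquality
open import Relation.Nullary using (yes; no; contradiction)

open import Algebra.Properties.Semiring.Sum +-*-semiring
  using (sum; sum-cong-≗; ∑-distrib-+; *-distribˡ-sum; *-distribʳ-sum)

-- Finite sums and indicators of subsets.

sum-mono : ∀ {n} {f g : Fin n → ℕ} → (∀ i → f i ≤ g i) → sum f ≤ sum g
sum-mono {zero}  f≤g = z≤n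
sum-mono {suc n} f≤g = +-mono-≤ (f≤g zero) (sum-mono (f≤g ∘ suc))

sum-mono-< : ∀ {n} {f g : Fin n → ℕ} → (∀ i → f i ≤ g i) → ∀ j → f j < g j → sum f < sum g
sum-mono-< f≤g zero    lt = +-mono-<-≤ lt (sum-mono (f≤g ∘ suc))
sum-mono-< f≤g (suc j) lt = +-mono-≤-< (f≤g zero) (sum-mono-< (f≤g ∘ suc) j lt)

sum-const : ∀ n x → sum {n} (λ _ → x) ≡ n * x
sum-const zero    x = refl
sum-const (suc n) x = cong (x +_) (sum-const n x)

indicator : Bool → ℕ
indicator true  = 1
indicator false = 0

sum-indicator : ∀ {n} (p : Subset n) → sum (λ i → indicator (lookup p i)) ≡ ∣ p ∣
sum-indicator []          = refl
sum-indicator (true ∷ p)  = cong suc (sum-indicator p)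
sum-indicator (false ∷ p) = sum-indicator p

∣p∣>0⇒nonempty : ∀ {n} (p : Subset n) → 1 ≤ ∣ p ∣ → ∃ λ i → lookup p i ≡ true
∣p∣>0⇒nonempty (true ∷ p)  _ = zero , refl
∣p∣>0⇒nonempty (false ∷ p) le with ∣p∣>0⇒nonempty p le
... | i , eq = suc i , eq

-- Sums over the cups before and after a round.

total : ∀ {n} → (ℕ → ℕ) → State n → ℕ
total f s = sum (λ i → f (s i))

neither : Bool → Bool → ℕ
neither false false = 1
neither _     _     = 0

module _ {n ℓ} {s s' : State n} (ρ : Round ℓ s s') where
  open Round ρ

  kept : (ℕ → ℕ) → ℕ
  kept f = sum (λ i → neither (lookup up i) (lookup down i) * f (s i))

  kept-mono : ∀ {f g} → (∀ x → f x ≤ g x) → kept f ≤ kept g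
  kept-mono f≤g = sum-mono (λ i → *-monoʳ-≤ (neither (lookup up i) (lookup down i)) (f≤g (s i)))

  kept-+ : ∀ f g → kept (λ x → f x + g x) ≡ kept f + kept g
  kept-+ f g = trans
    (sum-cong-≗ (λ i → *-distribˡ-+ (neither (lookup up i) (lookup down i)) (f (s i)) (g (s i))))
    (∑-distrib-+ (λ i → neither (lookup up i) (lookup down i) * f (s i)) (λ i → neither (lookup up i) (lookup down i) * g (s i)))

  private
    split : ∀ f x y →
      sum (λ i → indicator (lookup up i) * x + indicator (lookup down i) * y
                 + neither (lookup up i) (lookup down i) * f (s i))
      ≡ q * x + q * y + kept f
    split f x y = begin
      sum (λ i → raisedPart i + droppedPart i + neither (lookup up i) (lookup down i) * f (s i))
        ≡⟨ ∑-distrib-+ (λ i → raisedPart i + droppedPart i) (λ i → neither (lookup up i) (lookup down i) * f (s i)) ⟩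
      sum (λ i → raisedPart i + droppedPart i) + kept f
        ≡⟨ cong (_+ kept f) (∑-distrib-+ raisedPart droppedPart) ⟩
      sum raisedPart + sum droppedPart + kept f
        ≡⟨ cong₂ (λ a b → a + b + kept f) (size up x up-size) (size down y down-size) ⟩
      q * x + q * y + kept f ∎
      where
      open ≡-Reasoning
      raisedPart droppedPart : Fin n → ℕ
      raisedPart i = indicator (lookup up i) * x
      droppedPart i = indicator (lookup down i) * y
      size : ∀ (p : Subset n) z → ∣ p ∣ ≡ q → sum (λ i → indicator (lookup p i) * z) ≡ q * z
      size p z eq = trans (sym (*-distribʳ-sum z (λ i → indicator (lookup p i))))
                          (cong (_* z) (trans (sum-indicator p) eq))

  fill-up : ∀ i → lookup up i ≡ true → s i ≡ k0
  fill-up i eq = up-fill i (lookup⇒[]= i up eq)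

  fill-down : ∀ i → lookup down i ≡ true → s i ≡ k0
  fill-down i eq = down-fill i (lookup⇒[]= i down eq)

  -- The `2 * q` chosen cups are separated from the rest so that the old and the new total share the
  -- term `kept f`. Comparing them then only involves the values of `f` at `k0`, `suc k0` and
  -- `lowered ℓ k0`. Disjointness of `up` and `down` is what makes the three coefficients of each
  -- cup add up to 1.
  total-before : ∀ f → total f s ≡ q * f k0 + q * f k0 + kept f
  total-before f = trans (sum-cong-≗ pointwise) (split f (f k0) (f k0))
    where
    1a+0a+0a : ∀ a → a ≡ 1 * a + 0 * a + 0 * a
    1a+0a+0a = solve-∀
    0a+1a+0a : ∀ a → a ≡ 0 * a + 1 * a + 0 * a
    0a+1a+0a = solve-∀
    pointwise : ∀ i → f (s i) ≡ indicator (lookup up i) * f k0 + indicator (lookup down i) * f k0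
                                + neither (lookup up i) (lookup down i) * f (s i)
    pointwise i with lookup up i in u | lookup down i in d
    ... | true  | true  = contradiction (lookup⇒[]= i down d) (disjoint i (lookup⇒[]= i up u))
    ... | true  | false rewrite fill-up i u = 1a+0a+0a (f k0)
    ... | false | true  rewrite fill-down i d = 0a+1a+0a (f k0)
    ... | false | false = sym (+-identityʳ (f (s i)))

  total-after : ∀ f → total f s' ≡ q * f (suc k0) + q * f (lowered ℓ k0) + kept f
  total-after f = trans (sum-cong-≗ pointwise) (split f (f (suc k0)) (f (lowered ℓ k0)))
    where
    1a+0b+0c : ∀ a b c → a ≡ 1 * a + 0 * b + 0 * c
    1a+0b+0c = solve-∀
    0a+1b+0c : ∀ a b c → b ≡ 0 * a + 1 * b + 0 * c
    0a+1b+0c = solve-∀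
    pointwise : ∀ i → f (s' i) ≡ indicator (lookup up i) * f (suc k0)
                                 + indicator (lookup down i) * f (lowered ℓ k0)
                                 + neither (lookup up i) (lookup down i) * f (s i)
    pointwise i rewrite result i with lookup up i in u | lookup down i in d
    ... | true  | true  = contradiction (lookup⇒[]= i down d) (disjoint i (lookup⇒[]= i up u))
    ... | true  | false = 1a+0b+0c (f (suc k0)) (f (lowered ℓ k0)) (f (s i))
    ... | false | true  = 0a+1b+0c (f (suc k0)) (f (lowered ℓ k0)) (f (s i))
    ... | false | false = sym (+-identityʳ (f (s i)))

-- Absence of gaps and the number of high cups.

lowered-cases : ∀ ℓ x → lowered ℓ x ≡ x ⊎ lowered ℓ x ≡ x ∸ 1
lowered-cases ℓ x with ℓ ∣? x
... | yes _ = inj₁ refl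
... | no  _ = inj₂ refl

lowered≤ : ∀ ℓ x → lowered ℓ x ≤ x
lowered≤ ℓ x with ℓ ∣? x
... | yes _ = ≤-refl
... | no  _ = m∸n≤m x 1

NoGaps : ∀ {n} → State n → Set
NoGaps s = ∀ i v → v ≤ s i → ∃ λ j → s j ≡ v ⊎ s j ≡ suc v

module _ {n ℓ} {s s' : State n} (ρ : Round ℓ s s') where
  open Round ρ

  private
    raised : ∀ i → lookup up i ≡ true → s' i ≡ suc k0
    raised i u rewrite result i | u = refl

    dropped : ∀ i → lookup down i ≡ true → s' i ≡ lowered ℓ k0
    dropped i d rewrite result i with lookup up i in u
    ... | true = contradiction (lookup⇒[]= i down d) (disjoint i (lookup⇒[]= i up u))
    ... | false rewrite d = refl

    untouched : ∀ i → lookup up i ≡ false → lookup down i ≡ false → s' i ≡ s i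
    untouched i u d rewrite result i | u | d = refl

    fill-increase : ∀ i → s' i ≤ suc (s i)
    fill-increase i with lookup up i in u
    ... | true = ≤-reflexive (trans (raised i u) (cong suc (sym (fill-up ρ i u))))
    ... | false with lookup down i in d
    ...   | true = begin
      s' i          ≡⟨ dropped i d ⟩
      lowered ℓ k0  ≤⟨ lowered≤ ℓ k0 ⟩
      k0            ≡⟨ fill-down ρ i d ⟨
      s i           ≤⟨ n≤1+n (s i) ⟩
      suc (s i)     ∎
      where open ≤-Reasoning
    ...   | false = ≤-trans (≤-reflexive (untouched i u d)) (n≤1+n (s i))

    -- If the old witness was among the moved cups, the moved group supplies a new one: for `k0 ≡ v`
    -- a raised cup sits at `suc v`, and for `k0 ≡ suc v` a cup of `down` sits at `v` or, at a
    -- checkpoint, still at `suc v`. Both sets are inhabited because `q` is positive.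
    toppled : ∀ v → k0 ≡ v ⊎ k0 ≡ suc v → ∃ λ j → s' j ≡ v ⊎ s' j ≡ suc v
    toppled v (inj₁ refl) with ∣p∣>0⇒nonempty up (≤-trans q≥1 (≤-reflexive (sym up-size)))
    ... | i , u = i , inj₂ (raised i u)
    toppled v (inj₂ refl) with ∣p∣>0⇒nonempty down (≤-trans q≥1 (≤-reflexive (sym down-size))) | lowered-cases ℓ k0
    ... | i , d | inj₁ eq = i , inj₂ (trans (dropped i d) eq)
    ... | i , d | inj₂ eq = i , inj₁ (trans (dropped i d) eq)

  noGaps-step : NoGaps s → NoGaps s'
  noGaps-step gapless i v v≤ with m≤n⇒m<n∨m≡n v≤
  ... | inj₂ v≡ = i , inj₁ (sym v≡)
  -- A fill grows by at most one per round, so `v < s' i` gives `v ≤ s i` and the old state has a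
  -- witness for `v`.
  ... | inj₁ v< with gapless i v (s≤s⁻¹ (≤-trans v< (fill-increase i)))
  ...   | j , near with lookup up j in u | lookup down j in d
  ...     | true  | _     = toppled v (subst (λ x → x ≡ v ⊎ x ≡ suc v) (fill-up ρ j u) near)
  ...     | false | true  = toppled v (subst (λ x → x ≡ v ⊎ x ≡ suc v) (fill-down ρ j d) near)
  ...     | false | false = j , subst (λ x → x ≡ v ⊎ x ≡ suc v) (sym (untouched j u d)) near

noGaps-run : ∀ {n ℓ T} {s s' : State n} → Run ℓ T s s' → NoGaps s → NoGaps s'
noGaps-run done         gapless = gapless
noGaps-run (step ρ run) gapless = noGaps-run run (noGaps-step ρ gapless)

noGaps-initial : ∀ n → NoGaps (initial n)
noGaps-initial n i zero z≤n = i , inj₁ refl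

atLeast : ℕ → ℕ → ℕ
atLeast b v = indicator (b ≤ᵇ v)

atLeast-yes : ∀ {b v} → b ≤ v → atLeast b v ≡ 1
atLeast-yes {b} {v} b≤v with b ≤ᵇ v | ≤⇒≤ᵇ b≤v
... | true | _ = refl

atLeast-no : ∀ {b v} → v < b → atLeast b v ≡ 0
atLeast-no {b} {v} v<b with b ≤ᵇ v | ≤ᵇ⇒≤ b v
... | false | _ = refl
... | true  | f = contradiction (f _) (<⇒≱ v<b)

atLeast-anti : ∀ {b c} v → b ≤ c → atLeast c v ≤ atLeast b v
atLeast-anti {b} {c} v b≤c with c ≤? v
... | yes c≤v = ≤-reflexive (trans (atLeast-yes c≤v) (sym (atLeast-yes (≤-trans b≤c c≤v))))
... | no c≰v  = ≤-trans (≤-reflexive (atLeast-no (≰⇒> c≰v))) z≤n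

-- Each of the `m` disjoint height pairs `b`, `suc b`, then `2 + b`, `3 + b`, and so on holds a cup.
-- In the induction, the witness `j` for the lowest pair is counted by `atLeast b` but not by
-- `atLeast (2 + b)`, which makes the inequality strict.
noGaps-count : ∀ {n} {s : State n} → NoGaps s → ∀ m b i → b + 2 * m ≤ s i → m ≤ total (atLeast b) s
noGaps-count gapless zero    b i high = z≤n
noGaps-count {s = s} gapless (suc m) b i high with gapless i b (≤-trans (m≤m+n b _) high)
... | j , near = begin
  suc m                            ≤⟨ s≤s (noGaps-count gapless m (2 + b) i (≤-trans (≤-reflexive (shift b m)) high)) ⟩
  suc (total (atLeast (2 + b)) s)  ≤⟨ sum-mono-< (λ i → atLeast-anti (s i) (m≤n+m b 2)) j (gain near) ⟩
  total (atLeast b) s              ∎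
  where
  open ≤-Reasoning
  shift : ∀ b m → 2 + b + 2 * m ≡ b + 2 * suc m
  shift = solve-∀
  gain : ∀ {v} → v ≡ b ⊎ v ≡ suc b → atLeast (2 + b) v < atLeast b v
  gain (inj₁ refl) = ≤-reflexive (trans (cong suc (atLeast-no (s≤s (n≤1+n b)))) (sym (atLeast-yes (≤-refl {b}))))
  gain (inj₂ refl) = ≤-reflexive (trans (cong suc (atLeast-no (≤-refl {2 + b}))) (sym (atLeast-yes (n≤1+n b))))

-- The weights `p`, `w`, `r` and the pair kernel `g`.

module Potential (ℓ D : ℕ) .{{_ : NonZero ℓ}} (D≥1 : 1 ≤ D) where

  segment offset : ℕ → ℕ
  segment x = x / ℓ
  offset x = x % ℓ

  divMod-unique : ∀ v j → v < ℓ → segment (v + j * ℓ) ≡ j × offset (v + j * ℓ) ≡ v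
  divMod-unique v j v<ℓ =
    trans (+-distrib-/-∣ʳ v (divides-refl j)) (cong₂ _+_ (m<n⇒m/n≡0 v<ℓ) (m*n/n≡m j ℓ)) ,
    trans ([m+kn]%n≡m%n v j ℓ) (m<n⇒m%n≡m v<ℓ)

  data Up (x : ℕ) : Set where
    inside : segment (suc x) ≡ segment x → offset (suc x) ≡ suc (offset x) → Up x
    cross  : segment (suc x) ≡ suc (segment x) → offset (suc x) ≡ 0 → suc (offset x) ≡ ℓ → Up x

  up? : ∀ x → Up x
  up? x with m≤n⇒m<n∨m≡n (m%n<n x ℓ)
  ... | inj₁ lt = inside (trans (cong segment decompose) (proj₁ unique)) (trans (cong offset decompose) (proj₂ unique))
    where
    decompose : suc x ≡ suc (offset x) + segment x * ℓ
    decompose = cong suc (m≡m%n+[m/n]*n x ℓ)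
    unique = divMod-unique (suc (offset x)) (segment x) lt
  ... | inj₂ eq = cross (trans (cong segment decompose) (proj₁ unique)) (trans (cong offset decompose) (proj₂ unique)) eq
    where
    decompose : suc x ≡ 0 + suc (segment x) * ℓ
    decompose = trans (cong suc (m≡m%n+[m/n]*n x ℓ)) (cong (_+ segment x * ℓ) eq)
    unique = divMod-unique 0 (suc (segment x)) (>-nonZero⁻¹ ℓ)

  data Down (x : ℕ) : ℕ → Set where
    stay : offset x ≡ 0 → Down x x
    drop : ∀ {y} → x ≡ suc y → segment y ≡ segment x → offset x ≡ suc (offset y) → Down x y

  down? : ∀ x → Down x (lowered ℓ x)
  down? x with ℓ ∣? x
  ... | yes ℓ∣x = stay (n∣m⇒m%n≡0 x ℓ ℓ∣x)
  -- Height 0 is a checkpoint, so the truncated `0 ∸ 1` never arises.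
  down? zero    | no ℓ∤x = contradiction (divides-refl 0) ℓ∤x
  down? (suc y) | no ℓ∤x with up? y
  -- A move down from `suc y` reverses the move up from `y`; had that one crossed into a new
  -- segment, `suc y` would be a checkpoint.
  ... | inside same next = drop refl (sym same) next
  ... | cross _ zero-offset _ = contradiction (m%n≡0⇒n∣m (suc y) ℓ zero-offset) ℓ∤x

  -- Inside a segment `p` is constant, `r` is linear with slope `p`, and `w` is quadratic. The
  -- factor `suc D` per segment makes `w` continuous at a checkpoint, since
  -- `ℓ² + D ℓ² = (D + 1) ℓ²`, while `r` would reach `2 ℓ p` there and jumps to `(D + 1) ℓ p`, which
  -- is no smaller because `D ≥ 1`.
  p w r : ℕ → ℕ
  p x = suc D ^ segment x
  w x = p x * (ℓ * ℓ + D * (offset x * offset x))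
  r x = p x * (ℓ + offset x)

  p-up : ∀ x → p x ≤ p (suc x)
  p-up x with up? x
  ... | inside same _ = ≤-reflexive (cong (suc D ^_) (sym same))
  ... | cross next _ _ = ≤-trans (m≤n*m (p x) (suc D)) (≤-reflexive (cong (suc D ^_) (sym next)))

  p-down : ∀ {x y} → Down x y → p y ≡ p x
  p-down (stay _) = refl
  p-down (drop _ same _) = cong (suc D ^_) same

  r-up : ∀ x → r x + p x ≤ r (suc x)
  r-up x with up? x
  ... | inside same next rewrite same | next = ≤-reflexive (expand (p x) ℓ (offset x))
    where
    expand : ∀ a b c → a * (b + c) + a ≡ a * (b + suc c)
    expand = solve-∀
  ... | cross next zero-offset full rewrite next | zero-offset = begin
    p x * (ℓ + offset x) + p x  ≡⟨ collect (p x) ℓ (offset x) ⟩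
    p x * (ℓ + suc (offset x))  ≡⟨ cong (λ v → p x * (ℓ + v)) full ⟩
    p x * (ℓ + ℓ)               ≡⟨ double (p x) ℓ ⟩
    2 * (p x * (ℓ + 0))         ≤⟨ *-monoˡ-≤ (p x * (ℓ + 0)) (s≤s D≥1) ⟩
    suc D * (p x * (ℓ + 0))     ≡⟨ *-assoc (suc D) (p x) (ℓ + 0) ⟨
    suc D * p x * (ℓ + 0)       ∎
    where
    open ≤-Reasoning
    collect : ∀ a b c → a * (b + c) + a ≡ a * (b + suc c)
    collect = solve-∀
    double : ∀ a b → a * (b + b) ≡ 2 * (a * (b + 0))
    double = solve-∀

  r-down : ∀ {x y} → Down x y → r x ≤ r y + p x
  r-down {x} (stay _) = m≤m+n (r x) (p x)
  r-down {x} {y} (drop _ same next) rewrite next | same = ≤-reflexive (expand (p x) ℓ (offset y))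
    where
    expand : ∀ a b c → a * (b + suc c) ≡ a * (b + c) + a
    expand = solve-∀

  -- By continuity of `w`, the formula of the current segment remains valid at offset `ℓ`, so later
  -- arguments need not separate crossings.
  w-up : ∀ x → w (suc x) ≡ p x * (ℓ * ℓ + D * (suc (offset x) * suc (offset x)))
  w-up x with up? x
  ... | inside same next rewrite same | next = refl
  ... | cross next zero-offset full rewrite next | zero-offset =
    trans (expand D (p x) ℓ) (cong (λ v → p x * (ℓ * ℓ + D * (v * v))) (sym full))
    where
    expand : ∀ d a b → suc d * a * (b * b + d * (0 * 0)) ≡ a * (b * b + d * (b * b))
    expand = solve-∀

  -- The second difference of `D u²` is exactly `2 D`. At a checkpoint the lower cup stays, and only
  -- the first difference `D` from offset 0 to 1 appears.
  w-convex : ∀ {x y} → Down x y → w (suc x) + w y ≤ 2 * w x + 2 * (D * p x)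
  w-convex {x} (stay zero-offset) rewrite w-up x | zero-offset = begin
    p x * (ℓ * ℓ + D * (1 * 1)) + p x * (ℓ * ℓ + D * (0 * 0))  ≡⟨ expand (p x) (ℓ * ℓ) D ⟩
    2 * (p x * (ℓ * ℓ + D * (0 * 0))) + 1 * (D * p x)          ≤⟨ +-monoʳ-≤ (2 * (p x * (ℓ * ℓ + D * (0 * 0)))) (*-monoˡ-≤ (D * p x) (n≤1+n 1)) ⟩
    2 * (p x * (ℓ * ℓ + D * (0 * 0))) + 2 * (D * p x)          ∎
    where
    open ≤-Reasoning
    expand : ∀ a b d → a * (b + d * (1 * 1)) + a * (b + d * (0 * 0)) ≡ 2 * (a * (b + d * (0 * 0))) + 1 * (d * a)
    expand = solve-∀
  w-convex {x} {y} (drop _ same next) rewrite w-up x | same | next = ≤-reflexive (expand (p x) (ℓ * ℓ) D (offset y))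
    where
    expand : ∀ a b d u → a * (b + d * (suc (suc u) * suc (suc u))) + a * (b + d * (u * u))
                       ≡ 2 * (a * (b + d * (suc u * suc u))) + 2 * (d * a)
    expand = solve-∀

  -- As functions of the moving fill, p and r are convex inside a segment (the
  -- jump at its top only helps) and may have a concave kink at a checkpoint,
  -- which is never felt since cups do not fall below it. Hence g is convex in
  -- each variable, with a strict gain on the diagonal.
  g : ℕ → ℕ → ℕ
  g x y = p (x ⊓ y) * r (x ⊔ y)

  g-comm : ∀ x y → g x y ≡ g y x
  g-comm x y = cong₂ (λ a b → p a * r b) (⊓-comm x y) (⊔-comm x y)

  g-≤ : ∀ {x y} → x ≤ y → g x y ≡ p x * r y
  g-≤ x≤y = cong₂ (λ a b → p a * r b) (m≤n⇒m⊓n≡m x≤y) (m≤n⇒m⊔n≡n x≤y)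

  g-≥ : ∀ {x y} → y ≤ x → g x y ≡ p y * r x
  g-≥ {x} {y} y≤x = trans (g-comm x y) (g-≤ y≤x)

  down-≤ : ∀ {x y} → Down x y → y ≤ x
  down-≤ (stay _) = ≤-refl
  down-≤ (drop refl _ _) = n≤1+n _

  down-> : ∀ {x y z} → Down x y → z < x → z ≤ y
  down-> (stay _) z<x = <⇒≤ z<x
  down-> (drop refl _ _) z<x = s≤s⁻¹ z<x

  r-convex : ∀ {x y} → Down x y → 2 * r x ≤ r (suc x) + r y
  r-convex {x} {y} d = begin
    2 * r x            ≡⟨ cong (r x +_) (+-identityʳ (r x)) ⟩
    r x + r x          ≤⟨ +-monoʳ-≤ (r x) (r-down d) ⟩
    r x + (r y + p x)  ≡⟨ swap (r x) (r y) (p x) ⟩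
    r x + p x + r y    ≤⟨ +-monoˡ-≤ (r y) (r-up x) ⟩
    r (suc x) + r y    ∎
    where
    open ≤-Reasoning
    swap : ∀ a b c → a + (b + c) ≡ a + c + b
    swap = solve-∀

  r-mono-suc : ∀ x → r x ≤ r (suc x)
  r-mono-suc x = ≤-trans (m≤m+n (r x) (p x)) (r-up x)

  -- For `z` below `x` only the factor `r` moves, and `r-convex` applies. For `z` above `x` only `p`
  -- moves: it does not decrease upward and is unchanged downward. At `z ≡ x` the upward move
  -- changes `r` only and the downward move changes nothing, so monotonicity of `r` suffices.
  g-convex : ∀ {x y} → Down x y → ∀ z → 2 * g x z ≤ g (suc x) z + g y z
  g-convex {x} {y} d z with <-cmp z x
  ... | tri< z<x _ _
    rewrite g-≥ {x} (<⇒≤ z<x) | g-≥ {suc x} (m≤n⇒m≤1+n (<⇒≤ z<x)) | g-≥ {y} (down-> d z<x) = begin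
    2 * (p z * r x)              ≡⟨ swap (p z) (r x) ⟩
    p z * (2 * r x)              ≤⟨ *-monoʳ-≤ (p z) (r-convex d) ⟩
    p z * (r (suc x) + r y)      ≡⟨ *-distribˡ-+ (p z) (r (suc x)) (r y) ⟩
    p z * r (suc x) + p z * r y  ∎
    where
    open ≤-Reasoning
    swap : ∀ a b → 2 * (a * b) ≡ a * (2 * b)
    swap = solve-∀
  ... | tri≈ _ refl _
    rewrite g-≥ {x} ≤-refl | g-≥ {suc x} (n≤1+n x) | g-≤ {y} (down-≤ d) | p-down d = begin
    2 * (p x * r x)              ≡⟨ split (p x * r x) ⟩
    p x * r x + p x * r x        ≤⟨ +-monoˡ-≤ (p x * r x) (*-monoʳ-≤ (p x) (r-mono-suc x)) ⟩
    p x * r (suc x) + p x * r x  ∎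
    where
    open ≤-Reasoning
    split : ∀ a → 2 * a ≡ a + a
    split = solve-∀
  ... | tri> _ _ x<z
    rewrite g-≤ {x} (<⇒≤ x<z) | g-≤ {suc x} x<z | g-≤ {y} (≤-trans (down-≤ d) (<⇒≤ x<z)) | p-down d = begin
    2 * (p x * r z)              ≡⟨ split (p x * r z) ⟩
    p x * r z + p x * r z        ≤⟨ +-monoˡ-≤ (p x * r z) (*-monoˡ-≤ (r z) (p-up x)) ⟩
    p (suc x) * r z + p x * r z  ∎
    where
    open ≤-Reasoning
    split : ∀ a → 2 * a ≡ a + a
    split = solve-∀

  -- On the right, the three terms containing `suc x` have a maximum of `suc x` and each gain at
  -- least `p x * p x`, while the term `g y y` loses at most that much. The net gain is two such
  -- squares.
  g-diagonal : ∀ {x y} → Down x y →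
    4 * g x x + 2 * (p x * p x) ≤ g (suc x) (suc x) + g (suc x) y + (g y (suc x) + g y y)
  g-diagonal {x} {y} d
    rewrite g-≥ {x} ≤-refl | g-≥ {suc x} ≤-refl | g-≥ {suc x} (m≤n⇒m≤1+n (down-≤ d))
          | g-≤ {y} (m≤n⇒m≤1+n (down-≤ d)) | g-≥ {y} ≤-refl = begin
    4 * (p x * r x) + 2 * (p x * p x)
      ≡⟨ split (p x) (r x) ⟩
    p x * (3 * r x + 2 * p x) + p x * r x
      ≤⟨ +-monoʳ-≤ _ (*-monoʳ-≤ (p x) (r-down d)) ⟩
    p x * (3 * r x + 2 * p x) + p x * (r y + p x)
      ≡⟨ regroup (p x) (r x) (r y) ⟩
    3 * (p x * (r x + p x)) + p x * r y
      ≤⟨ +-monoˡ-≤ _ (*-monoʳ-≤ 3 (*-monoʳ-≤ (p x) (r-up x))) ⟩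
    3 * (p x * r (suc x)) + p x * r y
      ≡⟨ spread (p x * r (suc x)) (p x * r y) ⟩
    p x * r (suc x) + p x * r (suc x) + (p x * r (suc x) + p x * r y)
      ≤⟨ +-monoˡ-≤ _ (+-monoˡ-≤ _ (*-monoˡ-≤ (r (suc x)) (p-up x))) ⟩
    p (suc x) * r (suc x) + p x * r (suc x) + (p x * r (suc x) + p x * r y)
      ≡⟨ cong (λ a → p (suc x) * r (suc x) + a * r (suc x) + (a * r (suc x) + a * r y)) (p-down d) ⟨
    p (suc x) * r (suc x) + p y * r (suc x) + (p y * r (suc x) + p y * r y) ∎
    where
    open ≤-Reasoning
    split : ∀ a b → 4 * (a * b) + 2 * (a * a) ≡ a * (3 * b + 2 * a) + a * b
    split = solve-∀
    regroup : ∀ a b c → a * (3 * b + 2 * a) + a * (c + a) ≡ 3 * (a * (b + a)) + a * c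
    regroup = solve-∀
    spread : ∀ a b → 3 * a + b ≡ a + a + (a + b)
    spread = solve-∀

  w≥ : ∀ x → p x * (ℓ * ℓ) ≤ w x
  w≥ x = *-monoʳ-≤ (p x) (m≤m+n (ℓ * ℓ) _)

  r≤ : ∀ x → r x ≤ p x * (2 * ℓ)
  r≤ x = *-monoʳ-≤ (p x) (≤-trans (+-monoʳ-≤ ℓ (<⇒≤ (m%n<n x ℓ))) (≤-reflexive (cong (ℓ +_) (sym (+-identityʳ ℓ)))))

  g-bound-≤ : ∀ {x y} → x ≤ y → ℓ ^ 3 * g x y ≤ 2 * (w x * w y)
  g-bound-≤ {x} {y} x≤y = begin
    ℓ ^ 3 * g x y                          ≡⟨ cong (ℓ ^ 3 *_) (g-≤ x≤y) ⟩
    -- With `r y ≤ 2 ℓ p y` the left side has `2 ℓ⁴`, exactly twice the product of the two factors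
    -- `ℓ²` in the lower bounds for `w x` and `w y`.
    ℓ ^ 3 * (p x * r y)                    ≤⟨ *-monoʳ-≤ (ℓ ^ 3) (*-monoʳ-≤ (p x) (r≤ y)) ⟩
    ℓ ^ 3 * (p x * (p y * (2 * ℓ)))        ≡⟨ regroup ℓ (p x) (p y) ⟩
    2 * (p x * (ℓ * ℓ) * (p y * (ℓ * ℓ)))  ≤⟨ *-monoʳ-≤ 2 (*-mono-≤ (w≥ x) (w≥ y)) ⟩
    2 * (w x * w y)                        ∎
    where
    open ≤-Reasoning
    regroup : ∀ l a b → l * (l * (l * 1)) * (a * (b * (2 * l))) ≡ 2 * (a * (l * l) * (b * (l * l)))
    regroup = solve-∀

  g-bound : ∀ x y → ℓ ^ 3 * g x y ≤ 2 * (w x * w y)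
  g-bound x y with ≤-total x y
  ... | inj₁ x≤y = g-bound-≤ x≤y
  ... | inj₂ y≤x = begin
    ℓ ^ 3 * g x y    ≡⟨ cong (ℓ ^ 3 *_) (g-comm x y) ⟩
    ℓ ^ 3 * g y x    ≤⟨ g-bound-≤ y≤x ⟩
    2 * (w y * w x)  ≡⟨ cong (2 *_) (*-comm (w y) (w x)) ⟩
    2 * (w x * w y)  ∎
    where open ≤-Reasoning

-- Completing the square.

2ab≤a²+b² : ∀ a b → 2 * (a * b) ≤ a * a + b * b
2ab≤a²+b² a b with ≤-total a b
... | inj₁ a≤b with b ∸ a | m+[n∸m]≡n a≤b
...   | d | refl = ≤-trans (m≤m+n _ (d * d)) (≤-reflexive (square a d))
  where
  square : ∀ a d → 2 * (a * (a + d)) + d * d ≡ a * a + (a + d) * (a + d)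
  square = solve-∀
2ab≤a²+b² a b | inj₂ b≤a with a ∸ b | m+[n∸m]≡n b≤a
...   | d | refl = ≤-trans (m≤m+n _ (d * d)) (≤-reflexive (square b d))
  where
  square : ∀ b d → 2 * ((b + d) * b) + d * d ≡ (b + d) * (b + d) + b * b
  square = solve-∀

half≤difference : ∀ {a b} → b ≤ 2 * a → 2 * a ≤ 4 * a ∸ b
half≤difference {a} {b} b≤2a = m+n≤o⇒m≤o∸n (2 * a)
  (≤-trans (+-monoʳ-≤ (2 * a) b≤2a) (≤-reflexive (double a)))
  where
  double : ∀ a → 2 * a + 2 * a ≡ 4 * a
  double = solve-∀

-- Here `R` stands for `ℓ ^ 3`. Expanding the square of `F + 2 D z` gives a cross term `16 R D z F`,
-- at most `2 (R z)² + 32 (D F)²`. The growth of `G` pays for `2 (R z)²`. The last term `16 R D² z²`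
-- is at most `4 (D F)²`, so `36 (D F)²` remains, which is `18 D²` times `2 F² ≤ Q`.
energy-step : ∀ R D z F F′ G G′ → F′ ≤ F + 2 * (D * z) → G + 2 * (z * z) ≤ G′ →
  4 * (R * (z * z)) ≤ F * F → R * G ≤ 2 * (F * F) →
  R * (4 * (F′ * F′) ∸ R * G′) ≤ (R + 18 * (D * D)) * (4 * (F * F) ∸ R * G)
energy-step R D z F F′ G G′ F-grows G-grows z-small G-small = begin
  R * (4 * (F′ * F′) ∸ R * G′)          ≡⟨ *-distribˡ-∸ R (4 * (F′ * F′)) (R * G′) ⟩
  -- The subtracted term is moved to the other side, so that `main` is free of truncated
  -- subtraction.
  R * (4 * (F′ * F′)) ∸ R * (R * G′)    ≤⟨ m≤n+o⇒m∸n≤o _ (R * (R * G′)) main ⟩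
  (R + 18 * (D * D)) * Q                ∎
  where
  open ≤-Reasoning
  Q = 4 * (F * F) ∸ R * G
  Q-split : Q + R * G ≡ 4 * (F * F)
  Q-split = m∸n+n≡m (≤-trans G-small (*-monoˡ-≤ (F * F) {2} {4} (s≤s (s≤s z≤n))))
  Q-large : 2 * (F * F) ≤ Q
  Q-large = half≤difference {F * F} G-small
  expand : ∀ R D z F → R * (4 * ((F + 2 * (D * z)) * (F + 2 * (D * z))))
    ≡ R * (4 * (F * F)) + 2 * (2 * (R * z * (4 * (D * F)))) + 4 * (D * D) * (4 * (R * (z * z)))
  expand = solve-∀
  collect : ∀ R D z F G Q →
    R * (Q + R * G) + 2 * (R * z * (R * z) + 4 * (D * F) * (4 * (D * F))) + 4 * (D * D) * (F * F)
    ≡ R * (R * (G + 2 * (z * z))) + (R * Q + 18 * (D * D) * (2 * (F * F)))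
  collect = solve-∀
  main : R * (4 * (F′ * F′)) ≤ R * (R * G′) + (R + 18 * (D * D)) * Q
  main = begin
    R * (4 * (F′ * F′))
      ≤⟨ *-monoʳ-≤ R (*-monoʳ-≤ 4 (*-mono-≤ F-grows F-grows)) ⟩
    R * (4 * ((F + 2 * (D * z)) * (F + 2 * (D * z))))
      ≡⟨ expand R D z F ⟩
    R * (4 * (F * F)) + 2 * (2 * (R * z * (4 * (D * F)))) + 4 * (D * D) * (4 * (R * (z * z)))
      ≤⟨ +-mono-≤ (+-monoʳ-≤ (R * (4 * (F * F))) (*-monoʳ-≤ 2 (2ab≤a²+b² (R * z) (4 * (D * F)))))
                  (*-monoʳ-≤ (4 * (D * D)) z-small) ⟩
    R * (4 * (F * F)) + 2 * (R * z * (R * z) + 4 * (D * F) * (4 * (D * F))) + 4 * (D * D) * (F * F)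
      ≡⟨ cong (λ a → R * a + 2 * (R * z * (R * z) + 4 * (D * F) * (4 * (D * F))) + 4 * (D * D) * (F * F)) Q-split ⟨
    R * (Q + R * G) + 2 * (R * z * (R * z) + 4 * (D * F) * (4 * (D * F))) + 4 * (D * D) * (F * F)
      ≡⟨ collect R D z F G Q ⟩
    R * (R * (G + 2 * (z * z))) + (R * Q + 18 * (D * D) * (2 * (F * F)))
      ≤⟨ +-mono-≤ (*-monoʳ-≤ R (*-monoʳ-≤ R G-grows)) (+-monoʳ-≤ (R * Q) (*-monoʳ-≤ (18 * (D * D)) Q-large)) ⟩
    R * (R * G′) + (R * Q + 18 * (D * D) * Q)
      ≡⟨ cong (R * (R * G′) +_) (*-distribʳ-+ Q R (18 * (D * D))) ⟨
    R * (R * G′) + (R + 18 * (D * D)) * Q ∎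

total-scale : ∀ {n} {f h : ℕ → ℕ} c d (s : State n) → (∀ x → c * f x ≤ d * h x) → c * total f s ≤ d * total h s
total-scale {f = f} {h} c d s le = begin
  c * total f s            ≡⟨ *-distribˡ-sum c (λ i → f (s i)) ⟩
  sum (λ i → c * f (s i))  ≤⟨ sum-mono (λ i → le (s i)) ⟩
  sum (λ i → d * h (s i))  ≡⟨ *-distribˡ-sum d (λ i → h (s i)) ⟨
  d * total h s            ∎
  where open ≤-Reasoning

-- Growth of the energy along a run.

module Growth (ℓ D : ℕ) .{{_ : NonZero ℓ}} (D≥1 : 1 ≤ D) where
  open Potential ℓ D D≥1

  Φ G : ∀ {n} → State n → ℕ
  Φ s = total w s
  G s = total (λ a → total (g a) s) s

  G-bound : ∀ {n} (s : State n) → ℓ ^ 3 * G s ≤ 2 * (Φ s * Φ s)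
  G-bound s = ≤-trans (total-scale (ℓ ^ 3) (2 * Φ s) s inner) (≤-reflexive (*-assoc 2 (Φ s) (Φ s)))
    where
    inner : ∀ a → ℓ ^ 3 * total (g a) s ≤ 2 * Φ s * w a
    inner a = ≤-trans
      (total-scale (ℓ ^ 3) (2 * w a) s (λ b → ≤-trans (g-bound a b) (≤-reflexive (sym (*-assoc 2 (w a) (w b))))))
      (≤-reflexive (swap (w a) (Φ s)))
      where
      swap : ∀ a b → 2 * a * b ≡ 2 * b * a
      swap = solve-∀

  module _ {n} {s s' : State n} (ρ : Round ℓ s s') where
    open Round ρ

    private
      low = lowered ℓ k0
      d = down? k0
      z = q * p k0

    Φ-step : Φ s' ≤ Φ s + 2 * (D * z)
    Φ-step = begin
      Φ s'                                                  ≡⟨ total-after ρ w ⟩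
      q * w (suc k0) + q * w low + kept ρ w                 ≡⟨ cong (_+ kept ρ w) (*-distribˡ-+ q (w (suc k0)) (w low)) ⟨
      q * (w (suc k0) + w low) + kept ρ w                   ≤⟨ +-monoˡ-≤ (kept ρ w) (*-monoʳ-≤ q (w-convex d)) ⟩
      q * (2 * w k0 + 2 * (D * p k0)) + kept ρ w            ≡⟨ regroup q (w k0) D (p k0) (kept ρ w) ⟩
      q * w k0 + q * w k0 + kept ρ w + 2 * (D * z)          ≡⟨ cong (_+ 2 * (D * z)) (total-before ρ w) ⟨
      Φ s + 2 * (D * z)                                     ∎
      where
      open ≤-Reasoning
      regroup : ∀ q a d b c → q * (2 * a + 2 * (d * b)) + c ≡ q * a + q * a + c + 2 * (d * (q * b))
      regroup = solve-∀

    z-bound : 2 * (z * (ℓ * ℓ)) ≤ Φ s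
    z-bound = begin
      2 * (z * (ℓ * ℓ))                                ≡⟨ regroup q (p k0) (ℓ * ℓ) ⟩
      q * (p k0 * (ℓ * ℓ)) + q * (p k0 * (ℓ * ℓ))      ≤⟨ +-mono-≤ (*-monoʳ-≤ q (w≥ k0)) (*-monoʳ-≤ q (w≥ k0)) ⟩
      q * w k0 + q * w k0                              ≤⟨ m≤m+n _ (kept ρ w) ⟩
      q * w k0 + q * w k0 + kept ρ w                   ≡⟨ total-before ρ w ⟨
      Φ s                                              ∎
      where
      open ≤-Reasoning
      regroup : ∀ q a b → 2 * (q * a * b) ≡ q * (a * b) + q * (a * b)
      regroup = solve-∀

    z²-bound : 4 * (ℓ ^ 3 * (z * z)) ≤ Φ s * Φ s
    z²-bound = begin
      -- Squaring `z-bound` yields `ℓ ^ 4`; as `ℓ ≥ 1`, the weaker power `ℓ ^ 3` is enough.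
      4 * (ℓ ^ 3 * (z * z))                    ≤⟨ *-monoʳ-≤ 4 (*-monoˡ-≤ (z * z) (^-monoʳ-≤ ℓ (n≤1+n 3))) ⟩
      4 * (ℓ ^ 4 * (z * z))                    ≡⟨ regroup ℓ z ⟩
      2 * (z * (ℓ * ℓ)) * (2 * (z * (ℓ * ℓ)))  ≤⟨ *-mono-≤ z-bound z-bound ⟩
      Φ s * Φ s                                ∎
      where
      open ≤-Reasoning
      regroup : ∀ l z → 4 * (l * (l * (l * (l * 1))) * (z * z)) ≡ 2 * (z * (l * l)) * (2 * (z * (l * l)))
      regroup = solve-∀

    -- Ordered pairs of cups are split by how many of them move. Pairs of kept cups are unchanged,
    -- and pairs with one moved cup do not lose in total, by convexity in that variable. The `4 q²`
    -- pairs of moved cups form `q²` groups of four, each gaining `2 (p k0)²` by `g-diagonal`, hence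
    -- `2 z²` altogether.
    G-step : G s + 2 * (z * z) ≤ G s'
    G-step = begin
      G s + 2 * (z * z)
        ≡⟨ cong (_+ 2 * (z * z)) (total-before ρ F) ⟩
      q * F k0 + q * F k0 + kept ρ F + 2 * (z * z)
        ≡⟨ swap (q * F k0 + q * F k0) (kept ρ F) (2 * (z * z)) ⟩
      q * F k0 + q * F k0 + 2 * (z * z) + kept ρ F
        ≤⟨ +-mono-≤ toppled-gain (kept-mono ρ F≤F′) ⟩
      q * F′ (suc k0) + q * F′ low + kept ρ F′
        ≡⟨ total-after ρ F′ ⟨
      G s' ∎
      where
      open ≤-Reasoning
      F F′ : ℕ → ℕ
      F a = total (g a) s
      F′ a = total (g a) s'
      K : ℕ → ℕ
      K a = kept ρ (g a)
      swap : ∀ a b c → a + b + c ≡ a + c + b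
      swap = solve-∀
      double : ∀ a → a + a ≡ 2 * a
      double = solve-∀
      convex : ∀ a → 2 * g a k0 ≤ g a (suc k0) + g a low
      convex a rewrite g-comm a k0 | g-comm a (suc k0) | g-comm a low = g-convex d a
      F≤F′ : ∀ a → F a ≤ F′ a
      F≤F′ a = begin
        F a                                          ≡⟨ total-before ρ (g a) ⟩
        q * g a k0 + q * g a k0 + K a                ≡⟨ cong (_+ K a) (factor q (g a k0)) ⟩
        q * (2 * g a k0) + K a                       ≤⟨ +-monoˡ-≤ (K a) (*-monoʳ-≤ q (convex a)) ⟩
        q * (g a (suc k0) + g a low) + K a           ≡⟨ cong (_+ K a) (*-distribˡ-+ q (g a (suc k0)) (g a low)) ⟩
        q * g a (suc k0) + q * g a low + K a         ≡⟨ total-after ρ (g a) ⟨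
        F′ a                                         ∎
        where
        factor : ∀ q a → q * a + q * a ≡ q * (2 * a)
        factor = solve-∀
      K-convex : K k0 + K k0 ≤ K (suc k0) + K low
      K-convex = begin
        K k0 + K k0                                  ≡⟨ kept-+ ρ (g k0) (g k0) ⟨
        kept ρ (λ b → g k0 b + g k0 b)               ≤⟨ kept-mono ρ (λ b → ≤-trans (≤-reflexive (double (g k0 b))) (g-convex d b)) ⟩
        kept ρ (λ b → g (suc k0) b + g low b)        ≡⟨ kept-+ ρ (g (suc k0)) (g low) ⟩
        K (suc k0) + K low                           ∎
      toppled-gain : q * F k0 + q * F k0 + 2 * (z * z) ≤ q * F′ (suc k0) + q * F′ low
      toppled-gain = begin
        q * F k0 + q * F k0 + 2 * (z * z)
          ≡⟨ cong (λ a → q * a + q * a + 2 * (z * z)) (total-before ρ (g k0)) ⟩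
        q * (q * g k0 k0 + q * g k0 k0 + K k0) + q * (q * g k0 k0 + q * g k0 k0 + K k0) + 2 * (z * z)
          ≡⟨ expand q (g k0 k0) (K k0) (p k0) ⟩
        q * q * (4 * g k0 k0 + 2 * (p k0 * p k0)) + q * (K k0 + K k0)
          ≤⟨ +-mono-≤ (*-monoʳ-≤ (q * q) (g-diagonal d)) (*-monoʳ-≤ q K-convex) ⟩
        q * q * (g (suc k0) (suc k0) + g (suc k0) low + (g low (suc k0) + g low low)) + q * (K (suc k0) + K low)
          ≡⟨ collect q (g (suc k0) (suc k0)) (g (suc k0) low) (g low (suc k0)) (g low low) (K (suc k0)) (K low) ⟩
        q * (q * g (suc k0) (suc k0) + q * g (suc k0) low + K (suc k0)) + q * (q * g low (suc k0) + q * g low low + K low)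
          ≡⟨ cong₂ (λ a b → q * a + q * b) (total-after ρ (g (suc k0))) (total-after ρ (g low)) ⟨
        q * F′ (suc k0) + q * F′ low ∎
        where
        expand : ∀ q a k b → q * (q * a + q * a + k) + q * (q * a + q * a + k) + 2 * (q * b * (q * b))
                           ≡ q * q * (4 * a + 2 * (b * b)) + q * (k + k)
        expand = solve-∀
        collect : ∀ q a b c e k m → q * q * (a + b + (c + e)) + q * (k + m)
                                  ≡ q * (q * a + q * b + k) + q * (q * c + q * e + m)
        collect = solve-∀

  -- By `G-bound` the subtraction never truncates.
  energy : ∀ {n} → State n → ℕ
  energy s = 4 * (Φ s * Φ s) ∸ ℓ ^ 3 * G s

  energy-round : ∀ {n} {s s' : State n} → Round ℓ s s' →
    ℓ ^ 3 * energy s' ≤ (ℓ ^ 3 + 18 * (D * D)) * energy s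
  energy-round {s = s} {s'} ρ = energy-step (ℓ ^ 3) D (q * p k0) (Φ s) (Φ s') (G s) (G s')
    (Φ-step ρ) (G-step ρ) (z²-bound ρ) (G-bound s)
    where open Round ρ

  energy-run : ∀ {n T} {s s' : State n} → Run ℓ T s s' →
    (ℓ ^ 3) ^ T * energy s' ≤ (ℓ ^ 3 + 18 * (D * D)) ^ T * energy s
  energy-run done = ≤-refl
  energy-run {s = s} {s''} (step {T} {s' = s'} ρ run) = begin
    R * R ^ T * energy s''   ≡⟨ *-assoc R (R ^ T) (energy s'') ⟩
    R * (R ^ T * energy s'') ≤⟨ *-monoʳ-≤ R (energy-run run) ⟩
    R * (S ^ T * energy s')  ≡⟨ swap R (S ^ T) (energy s') ⟩
    S ^ T * (R * energy s')  ≤⟨ *-monoʳ-≤ (S ^ T) (energy-round ρ) ⟩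
    S ^ T * (S * energy s)   ≡⟨ rotate S (S ^ T) (energy s) ⟩
    S * S ^ T * energy s     ∎
    where
    open ≤-Reasoning
    R = ℓ ^ 3
    S = ℓ ^ 3 + 18 * (D * D)
    swap : ∀ a b c → a * (b * c) ≡ b * (a * c)
    swap = solve-∀
    rotate : ∀ a b c → b * (a * c) ≡ a * b * c
    rotate = solve-∀

-- Power inequalities, and from growth to the number of rounds.

^-distribʳ-* : ∀ a b n → (a * b) ^ n ≡ a ^ n * b ^ n
^-distribʳ-* a b zero    = refl
^-distribʳ-* a b (suc n) = trans (cong (a * b *_) (^-distribʳ-* a b n)) (interchange a b (a ^ n) (b ^ n))
  where
  interchange : ∀ a b c d → a * b * (c * d) ≡ a * c * (b * d)
  interchange = solve-∀

-- Bernoulli's inequality `1 + j/M ≤ (1 + 1/M)^j`, cleared of denominators.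
bernoulli : ∀ M j → (M + j) * M ^ j ≤ M * suc M ^ j
bernoulli M zero    = ≤-reflexive (cong (_* 1) (+-identityʳ M))
bernoulli M (suc j) = begin
  (M + suc j) * (M * M ^ j)          ≤⟨ m≤m+n _ (j * M ^ j) ⟩
  (M + suc j) * (M * M ^ j) + j * M ^ j ≡⟨ factor M j (M ^ j) ⟩
  suc M * ((M + j) * M ^ j)          ≤⟨ *-monoʳ-≤ (suc M) (bernoulli M j) ⟩
  suc M * (M * suc M ^ j)            ≡⟨ swap (suc M) M (suc M ^ j) ⟩
  M * (suc M * suc M ^ j)            ∎
  where
  open ≤-Reasoning
  factor : ∀ M j a → (M + suc j) * (M * a) + j * a ≡ suc M * ((M + j) * a)
  factor = solve-∀
  swap : ∀ a b c → a * (b * c) ≡ b * (a * c)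
  swap = solve-∀

-- (1 + 1/M)^j ≤ M / (M - j), with M - j = d.
reverse-bernoulli : ∀ M j d → d + j ≡ M → suc M ^ j * d ≤ M * M ^ j
reverse-bernoulli M zero d eq = ≤-reflexive (trans (+-identityʳ d) (trans (trans (sym (+-identityʳ d)) eq) (sym (*-identityʳ M))))
reverse-bernoulli M (suc j) d eq = begin
  suc M * suc M ^ j * d      ≡⟨ rotate (suc M) (suc M ^ j) d ⟩
  suc M ^ j * (d + M * d)    ≤⟨ *-monoʳ-≤ (suc M ^ j) (+-monoˡ-≤ (M * d) (≤-trans (m≤m+n d (suc j)) (≤-reflexive eq))) ⟩
  suc M ^ j * (M + M * d)    ≡⟨ regroup M (suc M ^ j) d ⟩
  M * (suc M ^ j * suc d)    ≤⟨ *-monoʳ-≤ M (reverse-bernoulli M j (suc d) (trans (sym (+-suc d j)) eq)) ⟩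
  M * (M * M ^ j)            ∎
  where
  open ≤-Reasoning
  rotate : ∀ a b c → a * b * c ≡ b * (a * c)
  rotate = solve-∀
  regroup : ∀ a b c → b * (a + a * c) ≡ a * (b * suc c)
  regroup = solve-∀

2^-cancel-≤ : ∀ m n → 2 ^ m ≤ 2 ^ n → m ≤ n
2^-cancel-≤ m n le with m ≤? n
... | yes m≤n = m≤n
... | no m≰n  = contradiction le (<⇒≱ (^-monoʳ-< 2 (s≤s (s≤s z≤n)) (≰⇒> m≰n)))

-- A substitute for logarithms: both sides are compared with powers of `1 + 1/M`, where `M = 2 R`.
-- Bernoulli gives `1 + C/R ≤ (1 + 1/M)^(2C)`, so `2^h ≤ (1 + 1/M)^E`. Raising this to the power `R`
-- and using `(1 + 1/M)^R ≤ 2` gives `2^(h R) ≤ 2^E`.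
growth-bound : ∀ h R C T .{{_ : NonZero R}} → 2 ^ h * R ^ T ≤ (R + C) ^ T → h * R ≤ 2 * C * T
growth-bound h R C T grows = 2^-cancel-≤ (h * R) E (*-cancelʳ-≤ _ _ (M ^ (E * R)) {{m^n≢0 M (E * R) {{M≢0}}}} (begin
  2 ^ (h * R) * M ^ (E * R)    ≡⟨ cong₂ _*_ (^-*-assoc 2 h R) (^-*-assoc M E R) ⟨
  (2 ^ h) ^ R * (M ^ E) ^ R    ≡⟨ ^-distribʳ-* (2 ^ h) (M ^ E) R ⟨
  (2 ^ h * M ^ E) ^ R          ≤⟨ ^-monoˡ-≤ R slow ⟩
  (suc M ^ E) ^ R              ≡⟨ ^-*-assoc (suc M) E R ⟩
  suc M ^ (E * R)              ≡⟨ cong (suc M ^_) (*-comm E R) ⟩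
  suc M ^ (R * E)              ≡⟨ ^-*-assoc (suc M) R E ⟨
  (suc M ^ R) ^ E              ≤⟨ ^-monoˡ-≤ E doubling ⟩
  (2 * M ^ R) ^ E              ≡⟨ ^-distribʳ-* 2 (M ^ R) E ⟩
  2 ^ E * (M ^ R) ^ E          ≡⟨ cong (2 ^ E *_) (trans (^-*-assoc M R E) (cong (M ^_) (*-comm R E))) ⟩
  2 ^ E * M ^ (E * R)          ∎))
  where
  open ≤-Reasoning
  M = 2 * R
  E = 2 * C * T
  M≢0 : NonZero M
  M≢0 = m*n≢0 2 R
  doubling : suc M ^ R ≤ 2 * M ^ R
  -- The choice `j = d = R` bounds `(1 + 1/M)^R` by `M / (M - R) = 2`.
  doubling = *-cancelʳ-≤ _ _ R (≤-trans (reverse-bernoulli M R R (double R)) (≤-reflexive (swap R (M ^ R))))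
    where
    double : ∀ a → a + a ≡ 2 * a
    double = solve-∀
    swap : ∀ a b → 2 * a * b ≡ 2 * b * a
    swap = solve-∀
  factor : (R + C) * M ^ (2 * C) ≤ R * suc M ^ (2 * C)
  factor = *-cancelˡ-≤ 2 (begin
    2 * ((R + C) * M ^ (2 * C))      ≡⟨ distribute R C (M ^ (2 * C)) ⟩
    (M + 2 * C) * M ^ (2 * C)        ≤⟨ bernoulli M (2 * C) ⟩
    M * suc M ^ (2 * C)              ≡⟨ *-assoc 2 R (suc M ^ (2 * C)) ⟩
    2 * (R * suc M ^ (2 * C))        ∎)
    where
    distribute : ∀ a b c → 2 * ((a + b) * c) ≡ (2 * a + 2 * b) * c
    distribute = solve-∀
  slow : 2 ^ h * M ^ E ≤ suc M ^ E
  slow = *-cancelˡ-≤ (R ^ T) {{m^n≢0 R T}} (begin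
    R ^ T * (2 ^ h * M ^ E)            ≡⟨ rotate (R ^ T) (2 ^ h) (M ^ E) ⟩
    2 ^ h * R ^ T * M ^ E              ≤⟨ *-monoˡ-≤ (M ^ E) grows ⟩
    (R + C) ^ T * M ^ E                ≡⟨ cong ((R + C) ^ T *_) (^-*-assoc M (2 * C) T) ⟨
    (R + C) ^ T * (M ^ (2 * C)) ^ T    ≡⟨ ^-distribʳ-* (R + C) (M ^ (2 * C)) T ⟨
    ((R + C) * M ^ (2 * C)) ^ T        ≤⟨ ^-monoˡ-≤ T factor ⟩
    (R * suc M ^ (2 * C)) ^ T          ≡⟨ ^-distribʳ-* R (suc M ^ (2 * C)) T ⟩
    R ^ T * (suc M ^ (2 * C)) ^ T      ≡⟨ cong (R ^ T *_) (^-*-assoc (suc M) (2 * C) T) ⟩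
    R ^ T * suc M ^ E                  ∎)
    where
    rotate : ∀ a b c → a * (b * c) ≡ b * a * c
    rotate = solve-∀

-- If `n` exceeded `N * k`, then `(n + k)^p` would exceed `N^p * k^p`, which is at least `N * k^p`
-- because `p ≥ 1` and `N ≥ 1`.
few-cups : ∀ p q n k h → 1 ≤ p → (n + k) ^ p ≤ 2 ^ (h * q) * k ^ p → n ≤ 2 ^ (h * q) * k
few-cups p@(suc p-1) q n k h _ le with n ≤? 2 ^ (h * q) * k
... | yes n≤ = n≤
... | no n≰  = contradiction le (<⇒≱ (begin-strict
  N * k ^ p          ≡⟨ cong (_* k ^ p) (*-identityʳ N) ⟨
  N ^ 1 * k ^ p      ≤⟨ *-monoˡ-≤ (k ^ p) (^-monoʳ-≤ N {{m^n≢0 2 (h * q)}} {1} {p} (s≤s z≤n)) ⟩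
  N ^ p * k ^ p      ≡⟨ ^-distribʳ-* N k p ⟨
  (N * k) ^ p        <⟨ ^-monoˡ-< p (<-≤-trans (≰⇒> n≰) (m≤m+n n k)) ⟩
  (n + k) ^ p        ∎))
  where
  open ≤-Reasoning
  N = 2 ^ (h * q)

-- Comparison of the initial and the final energy.

module Endgame (ℓ D : ℕ) .{{_ : NonZero ℓ}} (D≥1 : 1 ≤ D) where
  open Potential ℓ D D≥1
  open Growth ℓ D D≥1

  w-zero : w 0 ≡ ℓ * ℓ
  w-zero = trans (cong₂ (λ a b → suc D ^ a * (ℓ * ℓ + D * (b * b))) (0/n≡0 ℓ) (m*n%n≡0 0 ℓ)) (trivial (ℓ * ℓ) D)
    where
    trivial : ∀ a d → 1 * (a + d * (0 * 0)) ≡ a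
    trivial = solve-∀

  Φ-initial : ∀ n → Φ (initial n) ≡ n * (ℓ * ℓ)
  Φ-initial n = trans (sum-const n (w 0)) (cong (n *_) w-zero)

  w-high : ∀ j v → j * ℓ ≤ v → suc D ^ j * (ℓ * ℓ) ≤ w v
  w-high j v high = ≤-trans (*-monoˡ-≤ (ℓ * ℓ) (^-monoʳ-≤ (suc D) j≤)) (w≥ v)
    where
    j≤ : j ≤ v / ℓ
    j≤ = ≤-trans (≤-reflexive (sym (m*n/n≡m j ℓ))) (/-monoˡ-≤ ℓ high)

  -- A Markov-type bound: every cup counted lies in segment `j` or later, where `w` is at least
  -- `(D + 1)^j ℓ²`.
  Φ-high : ∀ {n} (s : State n) j b → j * ℓ ≤ b → suc D ^ j * (ℓ * ℓ) * total (atLeast b) s ≤ Φ s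
  Φ-high s j b high = ≤-trans (total-scale (suc D ^ j * (ℓ * ℓ)) 1 s pointwise) (≤-reflexive (*-identityˡ (Φ s)))
    where
    pointwise : ∀ v → suc D ^ j * (ℓ * ℓ) * atLeast b v ≤ 1 * w v
    pointwise v with b ≤? v
    ... | yes b≤v rewrite atLeast-yes b≤v | *-identityʳ (suc D ^ j * (ℓ * ℓ)) | *-identityˡ (w v) =
      w-high j v (≤-trans high b≤v)
    ... | no b≰v rewrite atLeast-no (≰⇒> b≰v) | *-zeroʳ (suc D ^ j * (ℓ * ℓ)) = z≤n

  energy-lower : ∀ {n} (s : State n) → 2 * (Φ s * Φ s) ≤ energy s
  energy-lower s = half≤difference {Φ s * Φ s} (G-bound s)

  mass-bound : ∀ {n k h T} {st : State n} → h * ℓ ≤ k → Run ℓ T (initial n) st → (∃ λ i → 4 * k ≤ st i) →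
    (ℓ ^ 3) ^ T * (k * suc D ^ (2 * h) * (k * suc D ^ (2 * h))) ≤ 2 * ((ℓ ^ 3 + 18 * (D * D)) ^ T * (n * n))
  mass-bound {n} {k} {h} {T} {st} hℓ≤k run (i , high) =
    *-cancelˡ-≤ (2 * (L * L)) {{m*n≢0 2 (L * L) {{_}} {{m*n≢0 L L {{L≢0}} {{L≢0}}}}}} (begin
      2 * (L * L) * (R ^ T * (k * W * (k * W)))     ≡⟨ regroup L (R ^ T) k W ⟩
      R ^ T * (2 * (W * L * k * (W * L * k)))       ≤⟨ *-monoʳ-≤ (R ^ T) (*-monoʳ-≤ 2 (*-mono-≤ mass mass)) ⟩
      R ^ T * (2 * (Φ st * Φ st))                   ≤⟨ *-monoʳ-≤ (R ^ T) (energy-lower st) ⟩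
      R ^ T * energy st                             ≤⟨ energy-run run ⟩
      -- The pair sum of the initial state is discarded; this costs at most a factor 2, as the
      -- energy lies between `2 Φ²` and `4 Φ²`.
      S ^ T * energy (initial n)                    ≤⟨ *-monoʳ-≤ (S ^ T) (m∸n≤m _ (R * G (initial n))) ⟩
      S ^ T * (4 * (Φ (initial n) * Φ (initial n))) ≡⟨ cong (λ a → S ^ T * (4 * (a * a))) (Φ-initial n) ⟩
      S ^ T * (4 * (n * L * (n * L)))               ≡⟨ collect (S ^ T) n L ⟩
      2 * (L * L) * (2 * (S ^ T * (n * n)))         ∎)
    where
    open ≤-Reasoning
    L = ℓ * ℓ
    R = ℓ ^ 3
    S = ℓ ^ 3 + 18 * (D * D)
    W = suc D ^ (2 * h)
    L≢0 : NonZero L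
    L≢0 = m*n≢0 ℓ ℓ
    -- The fill `4 * k` is split as `2 * k + 2 * k`: the upper half consists of `k` pairs of
    -- adjacent heights.
    many : k ≤ total (atLeast (2 * k)) st
    many = noGaps-count (noGaps-run run (noGaps-initial n)) k (2 * k) i (≤-trans (≤-reflexive (double k)) high)
      where
      double : ∀ a → 2 * a + 2 * a ≡ 4 * a
      double = solve-∀
    -- These `k` cups have fill at least `2 k ≥ 2 h ℓ`, so they lie in segment `2 * h` or later.
    mass : W * L * k ≤ Φ st
    mass = ≤-trans (*-monoʳ-≤ (W * L) many)
      (Φ-high st (2 * h) (2 * k) (≤-trans (≤-reflexive (*-assoc 2 h ℓ)) (*-monoʳ-≤ 2 hℓ≤k)))
    regroup : ∀ L r k W → 2 * (L * L) * (r * (k * W * (k * W))) ≡ r * (2 * (W * L * k * (W * L * k)))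
    regroup = solve-∀
    collect : ∀ s n L → s * (4 * (n * L * (n * L))) ≡ 2 * (L * L) * (2 * (s * (n * n)))
    collect = solve-∀

rounds-bound : ∀ q {n k h ℓ T} {st : State n} → 1 ≤ k → 1 ≤ h → 1 ≤ ℓ → h * ℓ ≤ k →
  n ≤ 2 ^ (h * q) * k → Run ℓ T (initial n) st → (∃ λ i → 4 * k ≤ st i) →
  h * ℓ ^ 3 ≤ 2 * (18 * (2 ^ suc q * 2 ^ suc q)) * T
rounds-bound q {n} {k} {h} {ℓ} {T} k≥1 h≥1 ℓ≥1 hℓ≤k n≤Nk run high =
  growth-bound h R (18 * (D * D)) T {{m^n≢0 ℓ 3}}
    -- Cancelling `k²` and `2 N²` leaves exactly the hypothesis of `growth-bound`.
    (*-cancelˡ-≤ (2 * (N * N)) {{m*n≢0 2 (N * N) {{_}} {{m*n≢0 N N}}}}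
      (*-cancelˡ-≤ (k * k) {{m*n≢0 k k}} (begin
        k * k * (2 * (N * N) * (2 ^ h * R ^ T))         ≡⟨ regroup k N (2 ^ h) (R ^ T) ⟩
        R ^ T * (k * k * (2 ^ h * (2 * (N * N))))       ≤⟨ *-monoʳ-≤ (R ^ T) (*-monoʳ-≤ (k * k) weight) ⟩
        R ^ T * (k * k * (W * W))                       ≡⟨ interchange (R ^ T) k W ⟩
        R ^ T * (k * W * (k * W))                       ≤⟨ Endgame.mass-bound ℓ D (m^n>0 2 (suc q)) {h = h} hℓ≤k run high ⟩
        2 * (S ^ T * (n * n))                           ≤⟨ *-monoʳ-≤ 2 (*-monoʳ-≤ (S ^ T) (*-mono-≤ n≤Nk n≤Nk)) ⟩
        2 * (S ^ T * (N * k * (N * k)))                 ≡⟨ collect (S ^ T) N k ⟩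
        k * k * (2 * (N * N) * S ^ T)                   ∎)))
  where
  open ≤-Reasoning
  D = 2 ^ suc q
  R = ℓ ^ 3
  S = ℓ ^ 3 + 18 * (D * D)
  N = 2 ^ (h * q)
  W = suc D ^ (2 * h)
  instance
    k≢0 : NonZero k
    k≢0 = >-nonZero k≥1
    ℓ≢0 : NonZero ℓ
    ℓ≢0 = >-nonZero ℓ≥1
    N≢0 : NonZero N
    N≢0 = m^n≢0 2 (h * q)
  -- `W²` is at least `2^(4 h (q + 1))`. It must cover `2^h` for the growth, `N² = 2^(2 h q)` for
  -- the number of cups, and one factor 2 for the two-sided energy bound, which is absorbed using
  -- `h ≥ 1`.
  exponent : h + (1 + (h * q + h * q)) ≤ suc q * (2 * h) + suc q * (2 * h)
  exponent = begin
    h + (1 + (h * q + h * q))                         ≤⟨ +-monoʳ-≤ h (+-monoˡ-≤ (h * q + h * q) h≥1) ⟩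
    h + (h + (h * q + h * q))                         ≤⟨ m≤m+n _ (2 * h + 2 * (h * q)) ⟩
    h + (h + (h * q + h * q)) + (2 * h + 2 * (h * q)) ≡⟨ total-exponent h q ⟩
    suc q * (2 * h) + suc q * (2 * h)                 ∎
    where
    total-exponent : ∀ h q → h + (h + (h * q + h * q)) + (2 * h + 2 * (h * q)) ≡ suc q * (2 * h) + suc q * (2 * h)
    total-exponent = solve-∀
  D^≤W : 2 ^ (suc q * (2 * h)) ≤ W
  D^≤W = ≤-trans (≤-reflexive (sym (^-*-assoc 2 (suc q) (2 * h)))) (^-monoˡ-≤ (2 * h) (n≤1+n D))
  weight : 2 ^ h * (2 * (N * N)) ≤ W * W
  weight = begin
    2 ^ h * (2 * (N * N))                              ≡⟨ cong (λ a → 2 ^ h * (2 * a)) (^-distribˡ-+-* 2 (h * q) (h * q)) ⟨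
    2 ^ h * 2 ^ (1 + (h * q + h * q))                  ≡⟨ ^-distribˡ-+-* 2 h (1 + (h * q + h * q)) ⟨
    2 ^ (h + (1 + (h * q + h * q)))                    ≤⟨ ^-monoʳ-≤ 2 exponent ⟩
    2 ^ (suc q * (2 * h) + suc q * (2 * h))            ≡⟨ ^-distribˡ-+-* 2 (suc q * (2 * h)) (suc q * (2 * h)) ⟩
    2 ^ (suc q * (2 * h)) * 2 ^ (suc q * (2 * h))      ≤⟨ *-mono-≤ D^≤W D^≤W ⟩
    W * W                                              ∎
  regroup : ∀ k N a r → k * k * (2 * (N * N) * (a * r)) ≡ r * (k * k * (a * (2 * (N * N))))
  regroup = solve-∀
  interchange : ∀ r k W → r * (k * k * (W * W)) ≡ r * (k * W * (k * W))
  interchange = solve-∀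
  collect : ∀ s N k → 2 * (s * (N * k * (N * k))) ≡ k * k * (2 * (N * N) * s)
  collect = solve-∀

-- Rounding in `k / h` and the final constants.

k≤2hℓ : ∀ k h .{{_ : NonZero h}} → h ≤ k → k ≤ 2 * (h * (k / h))
k≤2hℓ k h h≤k = begin
  k                        ≡⟨ m≡m%n+[m/n]*n k h ⟩
  k % h + k / h * h        ≤⟨ +-monoˡ-≤ (k / h * h) (<⇒≤ (m%n<n k h)) ⟩
  h + k / h * h            ≡⟨ cong (_+ k / h * h) (*-identityˡ h) ⟨
  -- As `h ≤ k`, the quotient is at least 1, so the remainder is dominated by `k / h * h`, and
  -- rounding costs at most a factor 2.
  1 * h + k / h * h        ≤⟨ +-monoˡ-≤ (k / h * h) (*-monoˡ-≤ h (m≥n⇒m/n>0 h≤k)) ⟩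
  k / h * h + k / h * h    ≡⟨ double (k / h) h ⟩
  2 * (h * (k / h))        ∎
  where
  open ≤-Reasoning
  double : ∀ a b → a * b + a * b ≡ 2 * (b * a)
  double = solve-∀

-- The constants are the rationals `c₁ = p/q`, `c₂ = r/s`, `c = a/b` and `c' = a'/b'`, and
-- logarithms have base 2. Exponentiating `c₁ log(n/k + 1) ≤ h` and clearing denominators gives
-- `(n + k)^p ≤ 2^(h q) k^p`; the upper bound on `h` is treated in the same way.
theorem6p6 : (p q r s : ℕ) → 1 ≤ p → 1 ≤ q → 1 ≤ r → 1 ≤ s → p * s ≤ r * q →
    Σ ℕ λ a → Σ ℕ λ b → Σ ℕ λ a' → Σ ℕ λ b' →
    1 ≤ a × 1 ≤ b × 1 ≤ a' × 1 ≤ b' ×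
    ((n k h T : ℕ) → (st : State n) →
    1 ≤ k → k ≤ n → 2 ≤ h → h ≤ k →
    (n + k) ^ p ≤ 2 ^ (h * q) * k ^ p →
    2 ^ (h * s) * k ^ r ≤ (n + k) ^ r →
    Run (fdiv k h) T (initial n) st →
    (∃ λ (i : Fin n) → 4 * k ≤ st i) →
    (a * (h * (fdiv k h) ^ 3) ≤ b * T) × (a' * k ^ 3 ≤ b' * (T * h ^ 2)))
theorem6p6 p q r s p≥1 _ _ _ _ =
  1 , B , 1 , 8 * B , ≤-refl , B≥1 , ≤-refl , *-mono-≤ {1} {8} (s≤s z≤n) B≥1 , bounds
  where
  -- `B` is the factor `2 * C` of `growth-bound` with `C = 18 D²` and `D = 2^(q+1)`. The further 8
  -- in the second bound comes from cubing `k ≤ 2 h ℓ`.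
  B = 2 * (18 * (2 ^ suc q * 2 ^ suc q))
  B≥1 : 1 ≤ B
  B≥1 = *-mono-≤ {1} {2} (s≤s z≤n) (*-mono-≤ {1} {18} (s≤s z≤n) (*-mono-≤ (m^n>0 2 (suc q)) (m^n>0 2 (suc q))))
  bounds : (n k h T : ℕ) → (st : State n) → 1 ≤ k → k ≤ n → 2 ≤ h → h ≤ k →
    (n + k) ^ p ≤ 2 ^ (h * q) * k ^ p → 2 ^ (h * s) * k ^ r ≤ (n + k) ^ r →
    Run (fdiv k h) T (initial n) st → (∃ λ (i : Fin n) → 4 * k ≤ st i) →
    (1 * (h * (fdiv k h) ^ 3) ≤ B * T) × (1 * k ^ 3 ≤ 8 * B * (T * h ^ 2))
  bounds n k zero T st _ _ () _ _ _ _ _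
  bounds n k h@(suc _) T st k≥1 _ h≥2 h≤k n-small _ run high =
    ≤-trans (≤-reflexive (*-identityˡ _)) hℓ³≤BT , (begin
      1 * k ^ 3                  ≡⟨ *-identityˡ (k ^ 3) ⟩
      k ^ 3                      ≤⟨ ^-monoˡ-≤ 3 (k≤2hℓ k h h≤k) ⟩
      (2 * (h * ℓ)) ^ 3          ≡⟨ expand h ℓ ⟩
      8 * (h * ℓ ^ 3) * h ^ 2    ≤⟨ *-monoˡ-≤ (h ^ 2) (*-monoʳ-≤ 8 hℓ³≤BT) ⟩
      8 * (B * T) * h ^ 2        ≡⟨ regroup B T (h ^ 2) ⟩
      8 * B * (T * h ^ 2)        ∎)
    where
    open ≤-Reasoning
    ℓ = k / h
    hℓ³≤BT : h * ℓ ^ 3 ≤ B * T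
    hℓ³≤BT = rounds-bound q {h = h} k≥1 (s≤s z≤n) (m≥n⇒m/n>0 h≤k)
      (≤-trans (≤-reflexive (*-comm h ℓ)) (m/n*n≤m k h)) (few-cups p q n k h p≥1 n-small) run high
    expand : ∀ h l → 2 * (h * l) * (2 * (h * l) * (2 * (h * l) * 1)) ≡ 8 * (h * (l * (l * (l * 1)))) * (h * (h * 1))
    expand = solve-∀
    regroup : ∀ b t a → 8 * (b * t) * a ≡ 8 * b * (t * a)
    regroup = solve-∀
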